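{- Given two Petri automata $\mathcal A,\mathcal B$ over $X$, testing whether $\mathcal G(\mathcal A)\subseteq\mathcal L(\mathcal B)$ is decidable.
   Context: A graph over $X$ is a tuple $\langle V,E,\iota,o\rangle$ with $V$ finite, $E\subseteq V\times X\times V$, and $\iota,o\in V$ (input, output); graphs are considered up to isomorphism. Series-parallel graphs: on graphs with edges labelled by formal terms built from letters with $\cdot$ and $\cap$, the SP-rewriting system has two rules: (parallel) replace two edges $(x,u,y),(x,v,y)$ by $(x,u\cap v,y)$; (series) if $w$ is neither the input nor the output and its only adjacent edges are $(x,u,w)$ and $(w,v,y)$, delete $w$ and these edges and add $(x,u\cdot v,y)$. A graph is series-parallel if it rewrites to a graph consisting of two distinct vertices, the input and the output, and exactly one edge, from input to output. A Petri automaton over $X$ is $\mathcal A=\langle P,\mathcal T,\iota\rangle$ with $P$ a finite set of places, $\mathcal T\subseteq\mathcal P(P)\times\mathcal P(X\times P)$ a finite set of transitions $t=\langle \mathrm{in}(t),\mathrm{out}(t)\rangle$ with $\mathrm{in}(t)\neq\emptyset$, each $\mathrm{out}(t)$ being finite, and $\iota\in P$, subject to the two constraints below. Let $\pi_2(\mathrm{out}(t))=\{p\mid\exists a,(a,p)\in\mathrm{out}(t)\}$. A state is a set $S\subseteq P$; $t$ is enabled in $S$ if $\mathrm{in}(t)\subseteq S$, and firing it leads to $(S\setminus\mathrm{in}(t))\cup\pi_2(\mathrm{out}(t))$. A run $R=t_0;\dots;t_n$ from $S_0$ to $S_{n+1}$ is a sequence of successively fired transitions, with intermediate states $S_0,S_1,\dots,S_{n+1}$;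 it is accepting if $S_0=\{\iota\}$ and $S_{n+1}=\emptyset$. A state is reachable if there is a run to it from $\{\iota\}$. The trace $\mathcal G(R)$ of an accepting run $t_0;\dots;t_n$ is the graph with vertices $\{0,\dots,n\}$, input $0$, output $n$, and edges $(k,a,l)$ whenever there is $(a,p)\in\mathrm{out}(t_k)$ with $l=\min\{l'>k\mid p\in\mathrm{in}(t_{l'})\}$. $\mathcal G(\mathcal A)$ is the set of traces of accepting runs. Constraint 1 (safety): whenever $t$ is enabled in a reachable state $S$, $(S\setminus\mathrm{in}(t))\cap\pi_2(\mathrm{out}(t))=\emptyset$. Constraint 2: every graph in $\mathcal G(\mathcal A)$ is series-parallel. A reading of a graph $G=\langle V,E,\iota_G,o_G\rangle$ along a run $R=t_0;\dots;t_n$ with intermediate states $S_0,S_1,\dots,S_{n+1}$ is a sequence of maps $\rho_k:S_k\to V$ ($0\le k\le n+1$) such that $\rho_0(S_0)=\{\iota_G\}$ and for all $0\le k\le n$: (1) $\rho_k(p)=\rho_k(q)$ for all $p,q\in\mathrm{in}(t_k)$; (2) if $\mathrm{out}(t_k)=\emptyset$ then $\rho_k(p)=o_G$ for all $p\in\mathrm{in}(t_k)$; (3) $\rho_{k+1}(p)=\rho_k(p)$ for all $p\in S_k\setminus\mathrm{in}(t_k)$; (4) $(\rho_k(p),x,\rho_{k+1}(q))\in E$ for all $p\in\mathrm{in}(t_k)$ and $(x,q)\in\mathrm{out}(t_k)$. $\mathcal L(R)$ is the set of graphs over $X$ that have a reading along $R$, and $\mathcal L(\mathcal A)$ is the union of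 $\mathcal L(R)$ over all accepting runs $R$ of $\mathcal A$. -}

module Defs where

open import Data.Fin.Base using (Fin; zero; suc; inject₁; fromℕ; punchIn; _<_; _≤_)
open import Data.Fin.Subset using (Subset; _∈_; _⊆_; ⊥; ⁅_⁆; ⋃; _∩_; _∪_; _─_; Nonempty)
open import Data.List.Base using (List; []; map)
import Data.List.Membership.Propositional as List
open import Data.Nat.Base using (ℕ; suc)
open import Data.Product.Base using (∃; _×_; _,_; proj₂)
open import Data.Sum.Base using (_⊎_)
open import Function.Base using (_∘_)
open import Function.Bundles using (_↔_; _⇔_; Inverse)
open import Level as Level using (0ℓ)
open import Relation.Binary.Construct.Closure.ReflexiveTransitive using (Star)
open import Relation.Binary.Core using (Rel)
open import Relation.Binary.PropositionalEquality.Core using (_≡_; _≢_)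
open import Relation.Unary using (Pred; ｛_｝; _∖_; _≐_) renaming (_∪_ to _∪ᴾ_)

------------------------------------------------------------------------
-- Graphs

-- Since graphs matter only up to isomorphism, the finite vertex set is
-- taken to be Fin n.
record Graph (X : Set) (n : ℕ) : Set₁ where
  field
    E : Pred (Fin n × X × Fin n) 0ℓ
    ι : Fin n
    o : Fin n

record _≅_ {X : Set} {m n : ℕ} (G : Graph X m) (H : Graph X n) : Set where
  private
    module G = Graph G
    module H = Graph H
  field
    vertices : Fin m ↔ Fin n
  open Inverse vertices using (to)
  field
    ι-preserved : to G.ι ≡ H.ι
    o-preserved : to G.o ≡ H.o
    E-preserved : ∀ x a y → G.E (x , a , y) ⇔ H.E (to x , a , to y)

------------------------------------------------------------------------
-- Series-parallel graphs

data Term (X : Set) : Set where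
  letter  : X → Term X
  _·ᵗ_    : Term X → Term X → Term X
  _∩ᵗ_    : Term X → Term X → Term X

TermGraph : Set → Set₁
TermGraph X = ∃ λ n → Graph (Term X) n

-- E is a set of triples, so "two edges (x , u , y) and (x , v , y)" means
-- u ≢ v.  In the series rule the vertices other than w are enumerated by
-- punchIn w : Fin n → Fin (suc n), whose image is exactly the complement of
-- w; the equations for ι and o therefore say in particular that w is neither
-- of them.
data _⟶_ {X : Set} : Rel (TermGraph X) (Level.suc 0ℓ) where
  parallel : ∀ {n} {G H : Graph (Term X) n} →
    let module G = Graph G
        module H = Graph H
    in
    ∀ x u v y → u ≢ v →
    G.E (x , u , y) → G.E (x , v , y) →
    H.ι ≡ G.ι → H.o ≡ G.o →
    H.E ≐ ((G.E ∖ (｛ (x , u , y) ｝ ∪ᴾ ｛ (x , v , y) ｝)) ∪ᴾ ｛ (x , (u ∩ᵗ v) , y) ｝) →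
    (n , G) ⟶ (n , H)
  series : ∀ {n} {G : Graph (Term X) (suc n)} {H : Graph (Term X) n} →
    let module G = Graph G
        module H = Graph H
    in
    ∀ w x u v y →
    G.E (punchIn w x , u , w) → G.E (w , v , punchIn w y) →
    (∀ z s z′ → G.E (z , s , z′) → z ≡ w ⊎ z′ ≡ w →
       (z , s , z′) ≡ (punchIn w x , u , w) ⊎
       (z , s , z′) ≡ (w , v , punchIn w y)) →
    G.ι ≡ punchIn w H.ι → G.o ≡ punchIn w H.o →
    H.E ≐ ((λ (z , s , z′) → G.E (punchIn w z , s , punchIn w z′))
           ∪ᴾ ｛ (x , (u ·ᵗ v) , y) ｝) →
    (suc n , G) ⟶ (n , H)

data SingleEdge {X : Set} : TermGraph X → Set₁ where
  singleEdge : {G : Graph (Term X) 2} → let open Graph G in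
    ι ≢ o → ∀ u → E ≐ ｛ (ι , u , o) ｝ → SingleEdge (2 , G)

termGraph : ∀ {X n} → Graph X n → Graph (Term X) n
termGraph G = record
  { E = λ (x , t , y) → ∃ λ a → t ≡ letter a × E (x , a , y)
  ; ι = ι
  ; o = o
  }
  where open Graph G

SeriesParallel : ∀ {X n} → Graph X n → Set₁
SeriesParallel {_} {n} G = ∃ λ H → Star _⟶_ (n , termGraph G) H × SingleEdge H

------------------------------------------------------------------------
-- Petri automata, without the two constraints

-- The list `out` stands for the finite set of its elements.
record Transition (X : Set) (P : ℕ) : Set where
  field
    inp   : Subset P
    out   : List (X × Fin P)
    inp≢∅ : Nonempty inp

  π₂out : Subset P
  π₂out = ⋃ (map (⁅_⁆ ∘ proj₂) out)

-- The set of places is Fin P; the list 𝒯 stands for the finite set of its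
-- elements.
record PetriNet (X : Set) : Set where
  field
    P : ℕ
    𝒯 : List (Transition X P)
    ι : Fin P

module _ {X : Set} (N : PetriNet X) where
  open PetriNet N
  open Transition

  State : Set
  State = Subset P

  Enabled : Transition X P → State → Set
  Enabled t S = inp t ⊆ S

  fire : Transition X P → State → State
  fire t S = (S ─ inp t) ∪ π₂out t

  -- Run k S S′ : the runs from S to S′ consisting of k transitions.
  data Run : ℕ → State → State → Set where
    []   : ∀ {S} → Run 0 S S
    step : ∀ {k S S′} (t : Transition X P) → t List.∈ 𝒯 → Enabled t S →
           Run k (fire t S) S′ → Run (suc k) S S′

  Reachable : State → Set
  Reachable S = ∃ λ k → Run k ⁅ ι ⁆ S

  -- An accepting run t₀;…;tₙ has suc n transitions; there is none of
  -- length 0, since ⁅ ι ⁆ ≢ ⊥.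
  AcceptingRun : ℕ → Set
  AcceptingRun n = Run (suc n) ⁅ ι ⁆ ⊥

module _ {X : Set} {N : PetriNet X} where
  open PetriNet N
  open Transition

  transition : ∀ {k S S′} → Run N k S S′ → Fin k → Transition X P
  transition (step t _ _ _) zero    = t
  transition (step _ _ _ R) (suc i) = transition R i

  state : ∀ {k S S′} → Run N k S S′ → Fin (suc k) → State N
  state {S = S} _              zero    = S
  state         (step _ _ _ R) (suc i) = state R i

  trace : ∀ {n} → AcceptingRun N n → Graph X (suc n)
  trace {n} R = record
    { E = λ (k , a , l) → ∃ λ p → (a , p) List.∈ out (transition R k) × FirstConsumer k p l
    ; ι = zero
    ; o = fromℕ n
    }
    where
    -- l = min { l′ > k ∣ p ∈ in(t_l′) }
    FirstConsumer : Fin (suc n) → Fin P → Fin (suc n) → Set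
    FirstConsumer k p l =
      k < l × p ∈ inp (transition R l) ×
      (∀ l′ → k < l′ → p ∈ inp (transition R l′) → l ≤ l′)

  -- The map ρₖ : Sₖ → V is represented by a function defined on all places,
  -- of which only the values on Sₖ are constrained.  As V is inhabited (by the
  -- input of G), every map on Sₖ arises in this way.
  record Reading {m k S S′} (G : Graph X m) (R : Run N k S S′) : Set where
    private module G = Graph G
    field
      ρ         : Fin (suc k) → Fin P → Fin m
      ρ-initial : ∀ v → (∃ λ p → p ∈ state R zero × ρ zero p ≡ v) ⇔ v ≡ G.ι
      ρ-inp     : ∀ i {p q} → p ∈ inp (transition R i) → q ∈ inp (transition R i) →
                  ρ (inject₁ i) p ≡ ρ (inject₁ i) q
      ρ-final   : ∀ i → out (transition R i) ≡ [] →
                  ∀ {p} → p ∈ inp (transition R i) → ρ (inject₁ i) p ≡ G.o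
      ρ-stable  : ∀ i {p} → p ∈ state R (inject₁ i) ─ inp (transition R i) →
                  ρ (suc i) p ≡ ρ (inject₁ i) p
      ρ-edge    : ∀ i {p x q} → p ∈ inp (transition R i) →
                  (x , q) List.∈ out (transition R i) →
                  G.E (ρ (inject₁ i) p , x , ρ (suc i) q)

------------------------------------------------------------------------
-- Petri automata

record PetriAutomaton (X : Set) : Set₁ where
  field
    net : PetriNet X
  open PetriNet net public
  open Transition
  field
    safe : ∀ {S} → Reachable net S → ∀ {t} → t List.∈ 𝒯 → Enabled net t S →
           (S ─ inp t) ∩ π₂out t ≡ ⊥
    seriesParallel : ∀ {n} (R : AcceptingRun net n) → SeriesParallel (trace R)

module _ {X : Set} (A : PetriAutomaton X) where
  open PetriAutomaton A using (net)

  𝓖 : ∀ {m} → Graph X m → Set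
  𝓖 G = ∃ λ n → ∃ λ (R : AcceptingRun net n) → G ≅ trace R

  𝓛 : ∀ {m} → Graph X m → Set
  𝓛 G = ∃ λ n → ∃ λ (R : AcceptingRun net n) → Reading G R

{-# OPTIONS --safe #-}
-- A run of B reading the trace of a run R of A can be reordered so that its
-- transitions fire in the order of the vertices of the trace: a transition
-- located at the first vertex commutes with an earlier one located elsewhere,
-- because edges never enter the first vertex and B is safe.  B may therefore be
-- simulated in rounds, one for each transition of A, its tokens being located
-- by the places of A whose next consumption they wait for.  Which placements of
-- tokens of B win against R, and which places of A are next consumed by the
-- same transition of R, is finite information that is computed from the last
-- transition of R backwards.  Hence whether some accepting run of A has a trace
-- that B cannot read is a reachability question in a finite graph.
module Submission where

open import Defs
open import Data.Bool.Base using (Bool; true; false)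
import Data.Bool.Properties as Bool
open import Data.Empty using () renaming (⊥ to Empty)
open import Data.Fin.Base using (Fin; zero; suc; inject₁; fromℕ; toℕ; _<_; _≤_)
import Data.Fin.Properties as Fin
open import Data.Fin.Subset using (Subset; Nonempty; _∈_; _∉_; ⊥; ⊤; ⁅_⁆; ⋃; _∩_; _─_)
open import Data.Fin.Subset.Properties
  using ( _∈?_; _⊆?_; ⊆-antisym; ∉⊥; ∈⊤; x∈⁅x⁆; x∈⁅y⁆⇒x≡y; x∈p∩q⁺; x∈p∪q⁺; x∈p∪q⁻
        ; x∈p∧x∉q⇒x∈p─q; p─q⊆p)
open import Data.List.Base as L using (List; []; _∷_; allFin; cartesianProduct; length)
import Data.List.Membership.Propositional as List
open import Data.List.Membership.Propositional.Properties
  using (∈-allFin; ∈-map⁺; ∈-cartesianProduct⁺)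
import Data.List.Relation.Unary.All as All
open import Data.List.Relation.Unary.Any as Any using (here; there; any?)
open import Data.List.Relation.Unary.Any.Properties using (lookup-index)
open import Data.Maybe.Base using (Maybe; just; nothing; fromMaybe)
import Data.Maybe.Properties as Maybe
open import Data.Nat.Base as ℕ using (ℕ; zero; suc; pred; z≤n; s≤s)
import Data.Nat.Properties as ℕ
open import Data.Product.Base using (∃; ∃₂; _×_; _,_; proj₁; proj₂)
import Data.Product.Properties as Product
open import Data.Sum.Base using (_⊎_; inj₁; inj₂; [_,_])
open import Data.Vec.Base as Vec using (Vec; []; _∷_; lookup)
import Data.Vec.Properties as Vec
open import Function.Base using (_∘_; case_of_; id)
open import Function.Bundles using (_⇔_; mk⇔; Equivalence; Inverse)
open import Function.Construct.Identity using (↔-id; ⇔-id)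
open import Level using (0ℓ)
open import Relation.Binary.Construct.Closure.ReflexiveTransitive using (Star; ε; _◅_; _◅◅_; gmap)
open import Relation.Binary.Core using (Rel)
open import Relation.Binary.Definitions using (DecidableEquality; Decidable)
open import Relation.Binary.PropositionalEquality
  using (_≡_; _≢_; refl; sym; trans; cong; subst; subst₂)
open import Relation.Nullary using (¬_; Dec; yes; no; does; contradiction)
open import Relation.Nullary.Decidable
  using (map′; _×-dec_; _⊎-dec_; _→-dec_; ¬?; dec-true; decidable-stable)
open import Relation.Unary using (Pred)
import Relation.Unary as Unary

open Transition

-- Finite types and reachability in finite graphs.

record Finite (A : Set) : Set where
  field
    elements : List A
    complete : ∀ x → x List.∈ elements
    _≟_      : DecidableEquality A

  ∃? : ∀ {Q : Pred A 0ℓ} → Unary.Decidable Q → Dec (∃ Q)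
  ∃? Q? = map′ Any.satisfied (λ (x , q) → Any.map (λ { refl → q }) (complete x)) (any? Q? elements)

Fin-finite : ∀ {n} → Finite (Fin n)
Fin-finite = record { elements = allFin _ ; complete = ∈-allFin ; _≟_ = Fin._≟_ }

Bool-finite : Finite Bool
Bool-finite = record
  { elements = true ∷ false ∷ []
  ; complete = λ { true → here refl ; false → there (here refl) }
  ; _≟_      = Bool._≟_
  }

module _ {A : Set} (finite : Finite A) where
  open Finite finite

  Maybe-finite : Finite (Maybe A)
  Maybe-finite = record
    { elements = nothing ∷ L.map just elements
    ; complete = λ { nothing → here refl ; (just x) → there (∈-map⁺ just (complete x)) }
    ; _≟_      = Maybe.≡-dec _≟_
    }

  ×-finite : ∀ {B} → Finite B → Finite (A × B)
  ×-finite B-finite = record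
    { elements = cartesianProduct elements B.elements
    ; complete = λ (x , y) → ∈-cartesianProduct⁺ (complete x) (B.complete y)
    ; _≟_      = Product.≡-dec _≟_ B._≟_
    }
    where module B = Finite B-finite

  Vec-finite : ∀ {n} → Finite (Vec A n)
  Vec-finite {zero} = record
    { elements = [] ∷ []
    ; complete = λ { [] → here refl }
    ; _≟_      = Vec.≡-dec _≟_
    }
  Vec-finite {suc n} = record
    { elements = L.map cons (cartesianProduct elements Tail.elements)
    ; complete = λ { (x ∷ xs) → ∈-map⁺ cons (∈-cartesianProduct⁺ (complete x) (Tail.complete xs)) }
    ; _≟_      = Vec.≡-dec _≟_
    }
    where
    module Tail = Finite (Vec-finite {n})
    cons : A × Vec A n → Vec A (suc n)
    cons (x , xs) = x ∷ xs

  -- Warshall's algorithm: Via R zs x y holds if y is reached from x along a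
  -- path whose intermediate nodes are all in zs.
  module _ (R : Rel A 0ℓ) where

    Via : List A → Rel A 0ℓ
    Via []       x y = x ≡ y ⊎ R x y
    Via (z ∷ zs) x y = Via zs x y ⊎ (Via zs x z × Via zs z y)

    Via⇒Star : ∀ zs {x y} → Via zs x y → Star R x y
    Via⇒Star []       (inj₁ refl)    = ε
    Via⇒Star []       (inj₂ r)       = r ◅ ε
    Via⇒Star (z ∷ zs) (inj₁ v)       = Via⇒Star zs v
    Via⇒Star (z ∷ zs) (inj₂ (v , w)) = Via⇒Star zs v ◅◅ Via⇒Star zs w

    Via-refl : ∀ zs {x} → Via zs x x
    Via-refl []       = inj₁ refl
    Via-refl (z ∷ zs) = inj₁ (Via-refl zs)

    Via-edge : ∀ zs {x y} → R x y → Via zs x y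
    Via-edge []       r = inj₂ r
    Via-edge (z ∷ zs) r = inj₁ (Via-edge zs r)

    -- Paths are joined at a node allowed as intermediate. If it is the head, only the part of the
    -- first path up to it and the part of the second path from it are kept. If both paths pass
    -- through a head other than it, the detour between the two visits is dropped.
    Via-trans : ∀ {zs z} → z List.∈ zs → ∀ {x y} → Via zs x z → Via zs z y → Via zs x y
    Via-trans {zs = z ∷ zs} (here refl) v w = inj₂ ([ id , proj₁ ] v , [ id , proj₂ ] w)
    Via-trans (there z∈) (inj₁ v)       (inj₁ w)       = inj₁ (Via-trans z∈ v w)
    Via-trans (there z∈) (inj₁ v)       (inj₂ (w , u)) = inj₂ (Via-trans z∈ v w , u)
    Via-trans (there z∈) (inj₂ (v , u)) (inj₁ w)       = inj₂ (v , Via-trans z∈ u w)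
    Via-trans (there z∈) (inj₂ (v , _)) (inj₂ (_ , w)) = inj₂ (v , w)

    Star⇒Via : ∀ {x y} → Star R x y → Via elements x y
    Star⇒Via ε        = Via-refl elements
    Star⇒Via (r ◅ rs) = Via-trans (complete _) (Via-edge elements r) (Star⇒Via rs)

    module _ (R? : Decidable R) where

      Via? : ∀ zs → Decidable (Via zs)
      Via? []       x y = (x ≟ y) ⊎-dec R? x y
      Via? (z ∷ zs) x y = Via? zs x y ⊎-dec (Via? zs x z ×-dec Via? zs z y)

      Star? : Decidable (Star R)
      Star? x y = map′ (Via⇒Star elements) Star⇒Via (Via? elements x y)

  -- `elements` may list an element twice; membership looks only at the position chosen by
  -- `complete`. As bit vectors, sets of elements again form a finite type.
  Subsets : Set
  Subsets = Subset (length elements)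

  infix 4 _∈ˢ_ _∈ˢ?_

  _∈ˢ_ : A → Subsets → Set
  x ∈ˢ W = Any.index (complete x) ∈ W

  _∈ˢ?_ : ∀ x W → Dec (x ∈ˢ W)
  x ∈ˢ? W = Any.index (complete x) ∈? W

-- Comprehension and choice over finite sets.

module _ {n : ℕ} {Q : Pred (Fin n) 0ℓ} (Q? : Unary.Decidable Q) where

  comprehension : Subset n
  comprehension = Vec.tabulate (does ∘ Q?)

  ∈-comprehension⁺ : ∀ {i} → Q i → i ∈ comprehension
  ∈-comprehension⁺ {i} q =
    Vec.lookup⇒[]= i comprehension (trans (Vec.lookup∘tabulate (does ∘ Q?) i) (dec-true (Q? i) q))

  ∈-comprehension⁻ : ∀ {i} → i ∈ comprehension → Q i
  ∈-comprehension⁻ {i} i∈ =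
    from-true (Q? i) (trans (sym (Vec.lookup∘tabulate (does ∘ Q?) i)) (Vec.[]=⇒lookup i∈))
    where
    from-true : (d : Dec (Q i)) → does d ≡ true → Q i
    from-true (yes q) _ = q

module _ {A : Set} (finite : Finite A) {Q : Pred A 0ℓ} (Q? : Unary.Decidable Q) where
  open Finite finite

  subsetOf : Subsets finite
  subsetOf = comprehension (Q? ∘ L.lookup elements)

  ∈-subsetOf⁺ : ∀ {x} → Q x → _∈ˢ_ finite x subsetOf
  ∈-subsetOf⁺ {x} q = ∈-comprehension⁺ (Q? ∘ L.lookup elements) (subst Q (lookup-index (complete x)) q)

  ∈-subsetOf⁻ : ∀ {x} → _∈ˢ_ finite x subsetOf → Q x
  ∈-subsetOf⁻ {x} x∈ =
    subst Q (sym (lookup-index (complete x))) (∈-comprehension⁻ (Q? ∘ L.lookup elements) x∈)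

-- Finite choice: it places the tokens that a firing produces while leaving the labels of all other
-- places alone.
overwrite : ∀ {n} {V : Set} (O : Subset n) (Q : Fin n → V → Set) (vs : Vec V n) →
  (∀ i → i ∈ O → ∃ (Q i)) →
  ∃ λ ws → (∀ i → i ∈ O → Q i (lookup ws i)) × (∀ i → i ∉ O → lookup ws i ≡ lookup vs i)
overwrite {V = V} O Q vs h = Vec.tabulate (proj₁ ∘ value) ,
  (λ i → subst (λ v → i ∈ O → Q i v) (eq i) (proj₁ (proj₂ (value i)))) ,
  (λ i → subst (λ v → i ∉ O → v ≡ lookup vs i) (eq i) (proj₂ (proj₂ (value i))))
  where
  value : ∀ i → ∃ λ v → (i ∈ O → Q i v) × (i ∉ O → v ≡ lookup vs i)
  value i with i ∈? O
  ... | yes i∈ = proj₁ (h i i∈) , (λ _ → proj₂ (h i i∈)) , contradiction i∈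
  ... | no i∉  = lookup vs i , (λ i∈ → contradiction i∈ i∉) , (λ _ → refl)
  eq : ∀ i → proj₁ (value i) ≡ lookup (Vec.tabulate (proj₁ ∘ value)) i
  eq i = sym (Vec.lookup∘tabulate (proj₁ ∘ value) i)

x∈p─q⇒x∉q : ∀ {n x} {p q : Subset n} → x ∈ p ─ q → x ∉ q
x∈p─q⇒x∉q {p = _ ∷ _} {true ∷ _}  (Vec.there x∈) (Vec.there x∈q) = x∈p─q⇒x∉q x∈ x∈q
x∈p─q⇒x∉q {p = _ ∷ _} {false ∷ _} (Vec.there x∈) (Vec.there x∈q) = x∈p─q⇒x∉q x∈ x∈q

∈π₂out⁺ : ∀ {X P} (t : Transition X P) {x p} → (x , p) List.∈ out t → p ∈ π₂out t
∈π₂out⁺ t = go (out t)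
  where
  go : ∀ os {x p} → (x , p) List.∈ os → p ∈ ⋃ (L.map (⁅_⁆ ∘ proj₂) os)
  go (_ ∷ _)  (here refl) = x∈p∪q⁺ (inj₁ (x∈⁅x⁆ _))
  go (_ ∷ os) (there o∈)  = x∈p∪q⁺ (inj₂ (go os o∈))

∈π₂out⁻ : ∀ {X P} (t : Transition X P) {p} → p ∈ π₂out t → ∃ λ x → (x , p) List.∈ out t
∈π₂out⁻ t = go (out t)
  where
  go : ∀ os {p} → p ∈ ⋃ (L.map (⁅_⁆ ∘ proj₂) os) → ∃ λ x → (x , p) List.∈ os
  go []             p∈ = contradiction p∈ ∉⊥
  go ((x , q) ∷ os) p∈ with x∈p∪q⁻ ⁅ q ⁆ _ p∈
  ... | inj₁ p∈q with refl ← x∈⁅y⁆⇒x≡y q p∈q = x , here refl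
  ... | inj₂ p∈os with x′ , o∈ ← go os p∈os = x′ , there o∈

-- Firings of a Petri net whose tokens are located in a graph.

-- A graph in which only the output, not the input, is singled out, and
-- whose vertices may be infinitely many.
record LGraph (X V : Set) : Set₁ where
  field
    edge  : V → X → V → Set
    final : V → Set

open LGraph

module _ {X : Set} (N : PetriNet X) where
  open PetriNet N

  ∈-fire⁺ˡ : ∀ u {T p} → p ∈ T → p ∉ inp u → p ∈ fire N u T
  ∈-fire⁺ˡ u p∈T p∉u = x∈p∪q⁺ (inj₁ (x∈p∧x∉q⇒x∈p─q p∈T p∉u))

  ∈-fire⁺ʳ : ∀ u {T p} → p ∈ π₂out u → p ∈ fire N u T
  ∈-fire⁺ʳ u p∈ = x∈p∪q⁺ (inj₂ p∈)

  ∈-fire⁻ : ∀ u {T p} → p ∈ fire N u T → (p ∈ T × p ∉ inp u) ⊎ p ∈ π₂out u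
  ∈-fire⁻ u {T} p∈ with x∈p∪q⁻ (T ─ inp u) (π₂out u) p∈
  ... | inj₁ p∈─ = inj₁ (p─q⊆p T (inp u) p∈─ , x∈p─q⇒x∉q p∈─)
  ... | inj₂ p∈out = inj₂ p∈out

  -- Safety relative to an arbitrary state, so that it becomes an invariant of firing.
  SafeFrom : State N → Set
  SafeFrom T = ∀ {k T′} → Run N k T T′ → ∀ {u} → u List.∈ 𝒯 → Enabled N u T′ →
               (T′ ─ inp u) ∩ π₂out u ≡ ⊥

  SafeFrom-fire : ∀ {T u} → SafeFrom T → u List.∈ 𝒯 → Enabled N u T → SafeFrom (fire N u T)
  SafeFrom-fire safe u∈ en R = safe (step _ u∈ en R)

  SafeFrom-disjoint : ∀ {T u p} → SafeFrom T → u List.∈ 𝒯 → Enabled N u T →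
                      p ∈ T → p ∉ inp u → p ∉ π₂out u
  SafeFrom-disjoint safe u∈ en p∈T p∉u p∈out =
    ∉⊥ (subst (_ ∈_) (safe [] u∈ en) (x∈p∩q⁺ (x∈p∧x∉q⇒x∈p─q p∈T p∉u , p∈out)))

  -- Every place carries a label, marked or not; by `Wins-cong` the labels of unmarked places are
  -- irrelevant.
  Config : Set → Set
  Config V = State N × Vec V P

  relabel : ∀ {V W} → (V → W) → Config V → Config W
  relabel f (T , λs) = T , Vec.map f λs

  module _ {V : Set} (G : LGraph X V) where

    -- The conditions on a reading at one transition. The vertex shared by the consumed tokens is
    -- the parameter `v`, so that firings can be sorted by vertex.
    record FiresBy (u : Transition X P) (v : V) (c c′ : Config V) : Set where
      constructor firesBy
      private
        T  = proj₁ c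
        T′ = proj₁ c′
        at = lookup (proj₂ c)
        at′ = lookup (proj₂ c′)
      field
        enabled : Enabled N u T
        target  : T′ ≡ fire N u T
        inputs  : ∀ p → p ∈ inp u → at p ≡ v
        last    : out u ≡ [] → final G v
        stable  : ∀ p → p ∈ T → p ∉ inp u → at′ p ≡ at p
        edges   : ∀ {x p} → (x , p) List.∈ out u → edge G v x (at′ p)

    Fires : V → Config V → Config V → Set
    Fires v c c′ = ∃ λ u → u List.∈ 𝒯 × FiresBy u v c c′

    Step : Config V → Config V → Set
    Step c c′ = ∃ λ v → Fires v c c′

    -- For c placing the token of the input place at the input of G, this is
    -- membership of G in the language of N.
    Wins : Config V → Set
    Wins c = ∃ λ λs → Star Step c (⊥ , λs)

    module _ (finite : Finite V) (edge? : ∀ v x w → Dec (edge G v x w))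
             (final? : ∀ v → Dec (final G v)) where
      open Finite finite

      FiresBy? : ∀ u v c c′ → Dec (FiresBy u v c c′)
      FiresBy? u v (T , λs) (T′ , λs′) = map′
        (λ (a , b , c , d , e , f) → firesBy (λ {_} → a) b c d e (λ o∈ → All.lookup f o∈))
        (λ (firesBy a b c d e f) → (λ {_} → a) , b , c , d , e , All.tabulate (λ o∈ → f o∈))
        (    inp u ⊆? T
       ×-dec Vec.≡-dec Bool._≟_ T′ (fire N u T)
       ×-dec Fin.all? (λ p → (p ∈? inp u) →-dec (lookup λs p ≟ v))
       ×-dec (empty? (out u) →-dec final? v)
       ×-dec Fin.all? (λ p → (p ∈? T) →-dec (¬? (p ∈? inp u) →-dec (lookup λs′ p ≟ lookup λs p)))
       ×-dec All.all? (λ (x , p) → edge? v x (lookup λs′ p)) (out u))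
        where
        empty? : ∀ {A : Set} (xs : List A) → Dec (xs ≡ [])
        empty? []      = yes refl
        empty? (_ ∷ _) = no λ ()

      Step? : ∀ c c′ → Dec (Step c c′)
      Step? c c′ = ∃? λ v → map′
        List.find
        (λ (u , u∈ , f) → List.lose u∈ f)
        (any? (λ u → FiresBy? u v c c′) 𝒯)

  module _ {V W : Set} {G : LGraph X V} {H : LGraph X W} (f : V → W)
           (f-edge : ∀ {v x w} → edge G v x w → edge H (f v) x (f w))
           (f-final : ∀ {v} → final G v → final H (f v)) where

    -- A firing inspects labels only through equalities, edges and finality, all of which a
    -- homomorphism `f` preserves.
    relabel-step : ∀ {c c′} → Step G c c′ → Step H (relabel f c) (relabel f c′)
    relabel-step {T , λs} {T′ , λs′} (v , u , u∈ , s) = f v , u , u∈ , record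
      { enabled = s.enabled
      ; target  = s.target
      ; inputs  = λ p p∈ → trans (Vec.lookup-map p f λs) (cong f (s.inputs p p∈))
      ; last    = λ e → f-final (s.last e)
      ; stable  = λ p p∈ p∉ → trans (Vec.lookup-map p f λs′)
                    (trans (cong f (s.stable p p∈ p∉)) (sym (Vec.lookup-map p f λs)))
      ; edges   = λ {x} {p} o∈ → subst (edge H (f v) x) (sym (Vec.lookup-map p f λs′))
                    (f-edge (s.edges o∈))
      }
      where module s = FiresBy s

    relabel-steps : ∀ {c c′} → Star (Step G) c c′ → Star (Step H) (relabel f c) (relabel f c′)
    relabel-steps = gmap (relabel f) relabel-step

    relabel-wins : ∀ {c} → Wins G c → Wins H (relabel f c)
    relabel-wins (λs , s) = Vec.map f λs , relabel-steps s

  module _ {V : Set} {G : LGraph X V} where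

    SafeFrom-step : ∀ {c c′} → SafeFrom (proj₁ c) → Step G c c′ → SafeFrom (proj₁ c′)
    SafeFrom-step safe (_ , _ , u∈ , s) rewrite FiresBy.target s =
      SafeFrom-fire safe u∈ (FiresBy.enabled s)

    SafeFrom-steps : ∀ {c c′} → SafeFrom (proj₁ c) → Star (Step G) c c′ → SafeFrom (proj₁ c′)
    SafeFrom-steps safe ε        = safe
    SafeFrom-steps safe (s ◅ ss) = SafeFrom-steps (SafeFrom-step safe s) ss

    -- Only the first firing looks at the given labels, and only at those of marked places; every
    -- later labelling is stored in the sequence itself.
    Wins-cong : ∀ {T} {λs μs : Vec V P} → (∀ p → p ∈ T → lookup λs p ≡ lookup μs p) →
                Wins G (T , λs) → Wins G (T , μs)
    Wins-cong eq (_ , ε) = _ , ε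
    Wins-cong eq (νs , (v , u , u∈ , s) ◅ ss) = νs , (v , u , u∈ , record
      { enabled = s.enabled
      ; target  = s.target
      ; inputs  = λ p p∈ → trans (sym (eq p (s.enabled p∈))) (s.inputs p p∈)
      ; last    = s.last
      ; stable  = λ p p∈ p∉ → trans (s.stable p p∈ p∉) (eq p p∈)
      ; edges   = s.edges
      }) ◅ ss
      where module s = FiresBy s

    -- Sorting firings by vertex.

    -- Firings at a source w can be moved to the front.  Safety is what keeps
    -- the later firing from marking a place that the earlier one empties.
    module _ {w : V} (source : ∀ {v x} → ¬ edge G v x w) where

      Elsewhere : Config V → Config V → Set
      Elsewhere c c′ = ∃ λ v → v ≢ w × Fires G v c c′

      swap : ∀ {a b c} → SafeFrom (proj₁ a) → Elsewhere a b → Fires G w b c →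
             ∃ λ b′ → Fires G w a b′ × Elsewhere b′ c
      swap {T , λs} {T₁ , λs₁} {T₂ , λs₂} safe (v , v≢w , u , u∈ , s) (u′ , u′∈ , s′)
        with refl ← FiresBy.target s | refl ← FiresBy.target s′ =
        (fire N u′ T , μs) , (u′ , u′∈ , s″) , (v , v≢w , u , u∈ , s‴)
        where
        module s = FiresBy s
        module s′ = FiresBy s′

        -- Fired first, `u′` gives its outputs the labels they have in `λs₂`; the other labels are
        -- still those of `λs`.
        patched : ∃ λ μs → (∀ p → p ∈ π₂out u′ → lookup μs p ≡ lookup λs₂ p) ×
                           (∀ p → p ∉ π₂out u′ → lookup μs p ≡ lookup λs p)
        patched = overwrite (π₂out u′) (λ p v → v ≡ lookup λs₂ p) λs (λ _ _ → _ , refl)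

        μs : Vec V P
        μs = proj₁ patched

        new : ∀ {p} → p ∈ π₂out u′ → lookup μs p ≡ lookup λs₂ p
        new = proj₁ (proj₂ patched) _

        old : ∀ {p} → p ∉ π₂out u′ → lookup μs p ≡ lookup λs p
        old = proj₂ (proj₂ patched) _

        -- A token produced by `u` lies at the end of an edge, hence not at `w`, where `u′`
        -- consumes.
        out∉inp : ∀ {p} → p ∈ π₂out u → p ∉ inp u′
        out∉inp p∈out p∈inp with x , o∈ ← ∈π₂out⁻ u p∈out =
          source (subst (edge G v x) (s′.inputs _ p∈inp) (s.edges o∈))

        inp′ : ∀ {p} → p ∈ inp u′ → p ∈ T × p ∉ inp u
        inp′ p∈ with ∈-fire⁻ u (s′.enabled p∈)
        ... | inj₁ both  = both
        ... | inj₂ p∈out = contradiction p∈ (out∉inp p∈out)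

        inputs′ : ∀ p → p ∈ inp u′ → lookup λs p ≡ w
        inputs′ p p∈ with p∈T , p∉u ← inp′ p∈ = trans (sym (s.stable p p∈T p∉u)) (s′.inputs p p∈)

        inp∉inp′ : ∀ {p} → p ∈ inp u → p ∉ inp u′
        inp∉inp′ p∈u p∈u′ = proj₂ (inp′ p∈u′) p∈u

        -- By `inp′` the transition `u′` is already enabled in `T`, so safety at `T` forbids it to
        -- mark a place that is marked and not consumed by it.
        kept : ∀ {p} → p ∈ T → p ∉ inp u′ → p ∉ π₂out u′
        kept = SafeFrom-disjoint safe u′∈ (proj₁ ∘ inp′)

        s″ : FiresBy G u′ w (T , λs) (fire N u′ T , μs)
        s″ = record
          { enabled = proj₁ ∘ inp′
          ; target  = refl
          ; inputs  = inputs′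
          ; last    = s′.last
          ; stable  = λ p p∈ p∉ → old (kept p∈ p∉)
          ; edges   = λ {x} o∈ → subst (edge G w x) (sym (new (∈π₂out⁺ u′ o∈))) (s′.edges o∈)
          }

        fire-comm : fire N u′ (fire N u T) ≡ fire N u (fire N u′ T)
        fire-comm = ⊆-antisym
          (λ p∈ → case ∈-fire⁻ u′ p∈ of λ where
            (inj₂ p∈out′) → ∈-fire⁺ˡ u (∈-fire⁺ʳ u′ p∈out′)
              (λ p∈u → kept (s.enabled p∈u) (inp∉inp′ p∈u) p∈out′)
            (inj₁ (p∈fire , p∉u′)) → case ∈-fire⁻ u p∈fire of λ where
              (inj₁ (p∈T , p∉u)) → ∈-fire⁺ˡ u (∈-fire⁺ˡ u′ p∈T p∉u′) p∉u
              (inj₂ p∈out)       → ∈-fire⁺ʳ u p∈out)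
          (λ p∈ → case ∈-fire⁻ u p∈ of λ where
            (inj₂ p∈out) → ∈-fire⁺ˡ u′ (∈-fire⁺ʳ u p∈out) (out∉inp p∈out)
            (inj₁ (p∈fire , p∉u)) → case ∈-fire⁻ u′ p∈fire of λ where
              (inj₁ (p∈T , p∉u′)) → ∈-fire⁺ˡ u′ (∈-fire⁺ˡ u p∈T p∉u) p∉u′
              (inj₂ p∈out′)       → ∈-fire⁺ʳ u′ p∈out′)

        s‴ : FiresBy G u v (fire N u′ T , μs) (fire N u′ (fire N u T) , λs₂)
        s‴ = record
          { enabled = λ p∈ → ∈-fire⁺ˡ u′ (s.enabled p∈) (inp∉inp′ p∈)
          ; target  = fire-comm
          ; inputs  = λ p p∈ → trans (old (kept (s.enabled p∈) (inp∉inp′ p∈))) (s.inputs p p∈)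
          ; last    = s.last
          ; stable  = λ p p∈ p∉u → case p ∈? π₂out u′ of λ where
              (yes p∈out′) → sym (new p∈out′)
              (no p∉out′)  → case ∈-fire⁻ u′ p∈ of λ where
                (inj₂ p∈out′) → contradiction p∈out′ p∉out′
                (inj₁ (p∈T , p∉u′)) → trans (s′.stable p (∈-fire⁺ˡ u p∈T p∉u) p∉u′)
                  (trans (s.stable p p∈T p∉u) (sym (old p∉out′)))
          ; edges   = λ {x} {p} o∈ → let p∈out = ∈π₂out⁺ u o∈ in
              subst (edge G v x) (sym (s′.stable p (∈-fire⁺ʳ u p∈out) (out∉inp p∈out))) (s.edges o∈)
          }

      commute : ∀ {a b c} → SafeFrom (proj₁ a) → Elsewhere a b → Star (Fires G w) b c →
                ∃ λ b′ → Star (Fires G w) a b′ × Elsewhere b′ c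
      commute safe e ε = _ , ε , e
      commute safe e (s ◅ ss)
        with b₁ , s₁ , e₁ ← swap safe e s
        with b′ , ss′ , e′ ← commute (SafeFrom-step {c′ = b₁} safe (w , s₁)) e₁ ss =
        b′ , s₁ ◅ ss′ , e′

      Avoids : Config V → Set
      Avoids (T , λs) = ∀ p → p ∈ T → lookup λs p ≢ w

      -- A token at `w` would survive the step, which consumes only tokens at `v`.
      Elsewhere-avoids : ∀ {c c′} → Elsewhere c c′ → Avoids c′ → Avoids c
      Elsewhere-avoids (v , v≢w , u , u∈ , s) avoids p p∈ with p ∈? inp u
      ... | yes p∈u = λ eq → v≢w (trans (sym (FiresBy.inputs s p p∈u)) eq)
      ... | no p∉u  = λ eq → avoids p (subst (p ∈_) (sym (FiresBy.target s)) (∈-fire⁺ˡ u p∈ p∉u))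
                                    (trans (FiresBy.stable s p p∈ p∉u) eq)

      -- Induction on the sequence: the tail is sorted first, and a first firing elsewhere is then
      -- commuted past the block of firings at `w`.
      sources-first : (∀ v → Dec (v ≡ w)) → ∀ {c} → SafeFrom (proj₁ c) → Wins G c →
                      ∃ λ c′ → Star (Fires G w) c c′ × Avoids c′ × Wins G c′
      sources-first w? safe (_ , ε) = _ , ε , (λ p p∈ → contradiction p∈ ∉⊥) , _ , ε
      sources-first w? safe (μs , s ◅ ss) with sources-first w? (SafeFrom-step safe s) (μs , ss)
      ... | c₁ , ws , avoids , νs , rest with w? (proj₁ s)
      ...   | yes refl = c₁ , proj₂ s ◅ ws , avoids , νs , rest
      ...   | no v≢w with c′ , ws′ , e ← commute safe (proj₁ s , v≢w , proj₂ s) ws =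
        c′ , ws′ , Elsewhere-avoids e avoids , νs , (proj₁ e , proj₂ (proj₂ e)) ◅ rest

-- Traces as graphs on the natural numbers.

-- Junk value: fromℕ n for the numbers greater than n.
clamp : ∀ n → ℕ → Fin (suc n)
clamp n       zero    = zero
clamp zero    (suc v) = zero
clamp (suc n) (suc v) = suc (clamp n v)

clamp-toℕ : ∀ n (i : Fin (suc n)) → clamp n (toℕ i) ≡ i
clamp-toℕ n       zero    = refl
clamp-toℕ (suc n) (suc i) = cong suc (clamp-toℕ n i)

clamp-fromℕ : ∀ n → clamp n n ≡ fromℕ n
clamp-fromℕ zero    = refl
clamp-fromℕ (suc n) = cong suc (clamp-fromℕ n)

module _ {X : Set} {N : PetriNet X} where
  open PetriNet N

  -- Junk value: the length of the run if no transition consumes p.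
  consumer : ∀ {m S S′} → Run N m S S′ → Fin P → ℕ
  consumer []             p = 0
  consumer (step t _ _ R) p with p ∈? inp t
  ... | yes _ = 0
  ... | no _  = suc (consumer R p)

  module _ {m S S′} {t : Transition X P} {t∈ : t List.∈ 𝒯} {en : Enabled N t S}
           {R : Run N m (fire N t S) S′} where

    consumer-now : ∀ {p} → p ∈ inp t → consumer (step t t∈ en R) p ≡ 0
    consumer-now {p} p∈ with p ∈? inp t
    ... | yes _ = refl
    ... | no p∉ = contradiction p∈ p∉

    consumer-later : ∀ {p} → p ∉ inp t → consumer (step t t∈ en R) p ≡ suc (consumer R p)
    consumer-later {p} p∉ with p ∈? inp t
    ... | yes p∈ = contradiction p∈ p∉
    ... | no _   = refl

  -- The trace by recursion on the run: vertex 0 is the first transition and the tail is shifted by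
  -- one. With vertices in `ℕ`, `suc` embeds the graph of the tail definitionally.
  runEdge : ∀ {m S S′} → Run N m S S′ → ℕ → X → ℕ → Set
  runEdge []             _       _ _       = Empty
  runEdge (step _ _ _ _) _       _ zero    = Empty
  runEdge (step t _ _ R) zero    a (suc l) = ∃ λ p → (a , p) List.∈ out t × consumer R p ≡ l
  runEdge (step _ _ _ R) (suc k) a (suc l) = runEdge R k a l

  runGraph : ∀ {m S S′} → Run N m S S′ → LGraph X ℕ
  runGraph {m} R = record { edge = runEdge R ; final = λ v → suc v ≡ m }

  FirstUse : ∀ {m S S′} → Run N m S S′ → Fin P → Fin m → Set
  FirstUse R p l = p ∈ inp (transition R l) × (∀ l′ → p ∈ inp (transition R l′) → l ≤ l′)

  FirstUse⇒consumer : ∀ {m S S′} (R : Run N m S S′) {p} l → FirstUse R p l → consumer R p ≡ toℕ l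
  FirstUse⇒consumer (step t t∈ en R) zero    (p∈ , _)   = consumer-now {t = t} {t∈} {en} {R} p∈
  FirstUse⇒consumer (step t t∈ en R) (suc l) (p∈ , min) = trans
    (consumer-later {t = t} {t∈} {en} {R} (λ p∈t → ℕ.n≮0 (min zero p∈t)))
    (cong suc (FirstUse⇒consumer R l (p∈ , λ l′ → ℕ.s≤s⁻¹ ∘ min (suc l′))))

  -- A token present at the start must be consumed before the run ends in `⊥`, so `consumer` does
  -- not take its junk value here.
  consumer⇒FirstUse : ∀ {m S} (R : Run N m S ⊥) {p} → p ∈ S →
    ∃ λ l → toℕ l ≡ consumer R p × FirstUse R p l
  consumer⇒FirstUse []             p∈ = contradiction p∈ ∉⊥
  consumer⇒FirstUse (step t _ _ R) {p} p∈ with p ∈? inp t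
  ... | yes p∈t = zero , refl , p∈t , λ _ _ → z≤n
  ... | no p∉t with l , eq , p∈l , min ← consumer⇒FirstUse R (∈-fire⁺ˡ N t p∈ p∉t) =
    suc l , cong suc eq , p∈l , λ where
      zero     p∈′ → contradiction p∈′ p∉t
      (suc l′) p∈′ → s≤s (min l′ p∈′)

  traceEdge : ∀ {m S S′} → Run N m S S′ → Fin m → X → Fin m → Set
  traceEdge R k a l = ∃ λ p → (a , p) List.∈ out (transition R k) ×
    k < l × p ∈ inp (transition R l) × (∀ l′ → k < l′ → p ∈ inp (transition R l′) → l ≤ l′)

  traceEdge⇒runEdge : ∀ {m S S′} (R : Run N m S S′) k {a} l →
    traceEdge R k a l → runEdge R (toℕ k) a (toℕ l)
  traceEdge⇒runEdge (step t _ _ R) zero (suc l) (p , o∈ , _ , p∈ , min) =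
    p , o∈ , FirstUse⇒consumer R l (p∈ , λ l′ → ℕ.s≤s⁻¹ ∘ min (suc l′) ℕ.z<s)
  traceEdge⇒runEdge (step t _ _ R) (suc k) (suc l) (p , o∈ , k<l , p∈ , min) =
    traceEdge⇒runEdge R k l (p , o∈ , ℕ.s≤s⁻¹ k<l , p∈ , λ l′ k<l′ → ℕ.s≤s⁻¹ ∘ min (suc l′) (s≤s k<l′))

  runEdge⇒traceEdge : ∀ {m S} (R : Run N m S ⊥) k {a} l → runEdge R k a l →
    ∃₂ λ k′ l′ → toℕ k′ ≡ k × toℕ l′ ≡ l × traceEdge R k′ a l′
  runEdge⇒traceEdge (step t _ _ R) zero (suc l) (p , o∈ , eq)
    with l′ , eq′ , p∈ , min ← consumer⇒FirstUse R (∈-fire⁺ʳ N t (∈π₂out⁺ t o∈)) =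
    zero , suc l′ , refl , cong suc (trans eq′ eq) , p , o∈ , ℕ.z<s , p∈ ,
      λ { (suc l″) _ p∈″ → s≤s (min l″ p∈″) }
  runEdge⇒traceEdge (step t _ _ R) (suc k) (suc l) e
    with k′ , l′ , eqk , eql , p , o∈ , k<l , p∈ , min ← runEdge⇒traceEdge R k l e =
    suc k′ , suc l′ , cong suc eqk , cong suc eql , p , o∈ , s≤s k<l , p∈ ,
      λ { (suc l″) k<l″ p∈″ → s≤s (min l″ (ℕ.s≤s⁻¹ k<l″) p∈″) }

-- Readings as sequences of located firings.

toLGraph : ∀ {X m} → Graph X m → LGraph X (Fin m)
toLGraph G = record { edge = λ v x w → Graph.E G (v , x , w) ; final = _≡ Graph.o G }

module _ {X : Set} {N : PetriNet X} where
  open PetriNet N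

  -- A `Reading` over an `LGraph`, minus the condition on the initial state; the tail of a run
  -- inherits it.
  record Labelling {V : Set} (G : LGraph X V) {k T T′} (R : Run N k T T′) : Set where
    field
      ρ      : Fin (suc k) → Fin P → V
      inputs : ∀ i {p q} → p ∈ inp (transition R i) → q ∈ inp (transition R i) →
               ρ (inject₁ i) p ≡ ρ (inject₁ i) q
      last   : ∀ i → out (transition R i) ≡ [] → ∀ {p} → p ∈ inp (transition R i) →
               final G (ρ (inject₁ i) p)
      stable : ∀ i {p} → p ∈ state R (inject₁ i) ─ inp (transition R i) → ρ (suc i) p ≡ ρ (inject₁ i) p
      edges  : ∀ i {p x q} → p ∈ inp (transition R i) → (x , q) List.∈ out (transition R i) →
               edge G (ρ (inject₁ i) p) x (ρ (suc i) q)

  module _ {V : Set} {G : LGraph X V} where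

    Labelling⇒Star : ∀ {k T T′} (R : Run N k T T′) (L : Labelling G R) →
      ∃ λ μs → Star (Step N G) (T , Vec.tabulate (Labelling.ρ L zero)) (T′ , μs)
    Labelling⇒Star [] L = _ , ε
    -- The firing is located at the label of any consumed place; `inp≢∅` provides one.
    Labelling⇒Star (step t t∈ en R) L with inp≢∅ t
    ... | p₀ , p₀∈ = proj₁ rest , (ρ zero p₀ , t , t∈ , record
        { enabled = en
        ; target  = refl
        ; inputs  = λ p p∈ → trans (at zero p) (inputs zero p∈ p₀∈)
        ; last    = λ e → last zero e p₀∈
        ; stable  = λ p p∈ p∉ → trans (at (suc zero) p)
                      (trans (stable zero (x∈p∧x∉q⇒x∈p─q p∈ p∉)) (sym (at zero p)))
        ; edges   = λ {x} {p} o∈ → subst (edge G _ x) (sym (at (suc zero) p)) (edges zero p₀∈ o∈)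
        }) ◅ proj₂ rest
      where
      open Labelling L
      at : ∀ i p → lookup (Vec.tabulate (ρ i)) p ≡ ρ i p
      at i = Vec.lookup∘tabulate (ρ i)
      rest = Labelling⇒Star R record
        { ρ      = ρ ∘ suc
        ; inputs = inputs ∘ suc
        ; last   = last ∘ suc
        ; stable = λ i → stable (suc i)
        ; edges  = λ i → edges (suc i)
        }

    -- The equation on the first labelling is what glues a firing to the labelling of the tail.
    Star⇒Labelling : ∀ {T T′ λs μs} → Star (Step N G) (T , λs) (T′ , μs) →
      ∃₂ λ k (R : Run N k T T′) → ∃ λ (L : Labelling G R) → Labelling.ρ L zero ≡ lookup λs
    Star⇒Labelling {λs = λs} ε = 0 , [] , record
      { ρ = λ _ → lookup λs ; inputs = λ () ; last = λ () ; stable = λ () ; edges = λ () } , refl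
    Star⇒Labelling {T} {λs = λs} (_◅_ {j = T₁ , λs₁} (v , u , u∈ , s) ss)
      with refl ← FiresBy.target s | k , R , L , eq ← Star⇒Labelling ss =
      suc k , step u u∈ s.enabled R , record
        { ρ      = λ { zero → lookup λs ; (suc i) → tail.ρ i }
        ; inputs = λ { zero p∈ q∈ → trans (s.inputs _ p∈) (sym (s.inputs _ q∈))
                     ; (suc i) → tail.inputs i }
        ; last   = λ { zero e p∈ → subst (final G) (sym (s.inputs _ p∈)) (s.last e)
                     ; (suc i) → tail.last i }
        ; stable = λ { zero {p} p∈ → trans (cong (λ f → f p) eq)
                         (s.stable _ (p─q⊆p T (inp u) p∈) (x∈p─q⇒x∉q p∈))
                     ; (suc i) → tail.stable i }
        ; edges  = λ { zero p∈ o∈ → subst₂ (λ v w → edge G v _ w) (sym (s.inputs _ p∈))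
                         (sym (cong (λ f → f _) eq)) (s.edges o∈)
                     ; (suc i) → tail.edges i }
        } , refl
      where
      module s = FiresBy s
      module tail = Labelling L

  Readable : ∀ {m} → Graph X m → Set
  Readable G = Wins N (toLGraph G) (⁅ ι ⁆ , Vec.replicate P (Graph.ι G))

  Reading⇒Readable : ∀ {m k} {G : Graph X m} {R : Run N k ⁅ ι ⁆ ⊥} → Reading G R → Readable G
  Reading⇒Readable {G = G} {R} r = Wins-cong N
    (λ p p∈ → trans (Vec.lookup∘tabulate (ρ zero) p)
      (trans (Equivalence.to (ρ-initial (ρ zero p)) (p , subst (p ∈_) (state-zero R) p∈ , refl))
        (sym (Vec.lookup-replicate p (Graph.ι G)))))
    (Labelling⇒Star R record
      { ρ = ρ ; inputs = ρ-inp ; last = ρ-final ; stable = ρ-stable ; edges = ρ-edge })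
    where
    open Reading r
    state-zero : ∀ {k S S′} (R : Run N k S S′) → S ≡ state R zero
    state-zero []             = refl
    state-zero (step _ _ _ _) = refl

  Readable⇒Reading : ∀ {m} {G : Graph X m} → Readable G →
    ∃ λ n → ∃ λ (R : AcceptingRun N n) → Reading G R
  Readable⇒Reading {G = G} (_ , ss) with Star⇒Labelling ss
  ... | zero , R , L , eq = contradiction (subst (ι ∈_) (empty R) (x∈⁅x⁆ ι)) ∉⊥
    where
    empty : ∀ {S S′} → Run N 0 S S′ → S ≡ S′
    empty [] = refl
  ... | suc n , R@(step _ _ _ _) , L , eq = n , R , record
      { ρ         = ρ
      ; ρ-initial = λ v → mk⇔
          (λ { (p , p∈ , refl) → initial p })
          (λ { refl → ι , x∈⁅x⁆ ι , initial ι })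
      ; ρ-inp     = inputs
      ; ρ-final   = last
      ; ρ-stable  = stable
      ; ρ-edge    = edges
      }
    where
    open Labelling L
    initial : ∀ p → ρ zero p ≡ Graph.ι G
    initial p = trans (cong (λ f → f p) eq) (Vec.lookup-replicate p (Graph.ι G))

-- Traces compared with run graphs.

module _ {X : Set} {A B : PetriNet X} {n} (R : AcceptingRun A n) where
  private module B = PetriNet B

  start : Config B ℕ
  start = ⁅ B.ι ⁆ , Vec.replicate B.P 0

  Readable⇒Wins : Readable {N = B} (trace R) → Wins B (runGraph R) start
  Readable⇒Wins w = subst (λ λs → Wins B (runGraph R) (⁅ B.ι ⁆ , λs)) (Vec.map-replicate toℕ _ _)
    (relabel-wins B {H = runGraph R} toℕ
      (λ {k} {_} {l} → traceEdge⇒runEdge R k l)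
      (λ { refl → cong suc (Fin.toℕ-fromℕ n) }) w)

  -- `clamp n` undoes `toℕ`, and since `R` ends in `⊥` every edge of `runGraph R` comes from an edge
  -- of the trace, with both ends in range.
  Wins⇒Readable : Wins B (runGraph R) start → Readable {N = B} (trace R)
  Wins⇒Readable w = subst (λ λs → Wins B (toLGraph (trace R)) (⁅ B.ι ⁆ , λs))
    (Vec.map-replicate (clamp n) _ _)
    (relabel-wins B {G = runGraph R} {H = toLGraph (trace R)} (clamp n)
      (λ {k} {a} {l} e → case runEdge⇒traceEdge R k l e of λ
        { (k′ , l′ , refl , refl , e′) →
          subst₂ (λ v w → traceEdge R v a w) (sym (clamp-toℕ n k′)) (sym (clamp-toℕ n l′)) e′ })
      (λ { refl → clamp-fromℕ n }) w)

Reading-≅ : ∀ {X m m′ k} {N : PetriNet X} {G : Graph X m} {H : Graph X m′} {T T′} {R : Run N k T T′} →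
            G ≅ H → Reading H R → Reading G R
Reading-≅ {G = G} {H} iso r = record
  { ρ         = λ i p → from (ρ i p)
  ; ρ-initial = λ v → mk⇔
      (λ { (p , p∈ , refl) → trans (cong from (Equivalence.to (ρ-initial _) (p , p∈ , refl)))
                                     (from-to ι-preserved) })
      (λ { refl → let p , p∈ , eq = Equivalence.from (ρ-initial _) refl in
                  p , p∈ , trans (cong from eq) (from-to ι-preserved) })
  ; ρ-inp     = λ i p∈ q∈ → cong from (ρ-inp i p∈ q∈)
  ; ρ-final   = λ i e p∈ → trans (cong from (ρ-final i e p∈)) (from-to o-preserved)
  ; ρ-stable  = λ i p∈ → cong from (ρ-stable i p∈)
  ; ρ-edge    = λ i {x = x} p∈ o∈ → Equivalence.from (E-preserved _ x _)
      (subst₂ (λ v w → Graph.E H (v , x , w)) (sym (to-from _)) (sym (to-from _)) (ρ-edge i p∈ o∈))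
  }
  where
  open _≅_ iso
  open Inverse vertices
  open Reading r
  from-to : ∀ {v w} → to v ≡ w → from w ≡ v
  from-to refl = strictlyInverseʳ _
  to-from : ∀ w → to (from w) ≡ w
  to-from = strictlyInverseˡ

-- Rounds of `B` against one transition of `A`.

module Rounds {X : Set} (_≟X_ : DecidableEquality X) (A B : PetriNet X) where
  private
    module A = PetriNet A
    module B = PetriNet B

  -- A token of B waiting at the vertex where the place p of A is consumed is
  -- represented by p.
  Tokens : Set
  Tokens = Config B (Fin A.P)

  abstract
    Tokens-finite : Finite Tokens
    Tokens-finite = ×-finite (Vec-finite Bool-finite) (Vec-finite Fin-finite)

  -- Meant for the kernel of the map `consumer R`, stored as the vector of its classes.
  Kernel : Set
  Kernel = Vec (Subset A.P) A.P

  _∼[_]_ : Fin A.P → Kernel → Fin A.P → Set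
  p ∼[ κ ] q = p ∈ lookup κ q

  locate : Transition X A.P → Fin A.P → Maybe (Fin A.P)
  locate t p with p ∈? inp t
  ... | yes _ = nothing
  ... | no _  = just p

  -- The part of a trace visible while A fires t: `nothing` is the vertex of t
  -- and `just p` the vertex where p is consumed afterwards.  Several labels may
  -- lead to the same vertex through different places, hence κ, the relation of
  -- being consumed by the same transition.
  module _ (t : Transition X A.P) (S′ : State A) (κ : Kernel) where

    roundGraph : LGraph X (Maybe (Fin A.P))
    roundGraph = record { edge = edge′ ; final = final′ }
      where
      edge′ : Maybe (Fin A.P) → X → Maybe (Fin A.P) → Set
      edge′ nothing  x (just p) = ∃ λ q → (x , q) List.∈ out t × q ∼[ κ ] p
      edge′ nothing  x nothing  = Empty
      edge′ (just _) x _        = Empty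
      final′ : Maybe (Fin A.P) → Set
      final′ nothing  = S′ ≡ ⊥
      final′ (just _) = Empty

    -- All steps take place at `nothing`, as a `just` vertex has no outgoing edge and is not final.
    -- The closing equation says that no token is left at `nothing`.
    Round : Tokens → Tokens → Set
    Round c (T′ , ps) = ∃ λ νs →
      Star (Step B roundGraph) (relabel B (locate t) c) (T′ , νs) ×
      (∀ q → q ∈ T′ → lookup νs q ≡ just (lookup ps q))

    Round? : Decidable Round
    Round? c (T′ , ps) = Finite.∃? (Vec-finite Places-finite) λ νs →
      Star? (×-finite (Vec-finite Bool-finite) (Vec-finite Places-finite)) _
        (Step? B roundGraph Places-finite edge? final?) _ _ ×-dec
      Fin.all? (λ q → (q ∈? T′) →-dec Finite._≟_ Places-finite _ _)
      where
      Places-finite : Finite (Maybe (Fin A.P))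
      Places-finite = Maybe-finite Fin-finite
      edge? : ∀ v x w → Dec (edge roundGraph v x w)
      edge? nothing x (just p) = map′
        (λ any → case List.find any of λ { ((_ , q) , o∈ , refl , q∼p) → q , o∈ , q∼p })
        (λ (q , o∈ , q∼p) → List.lose o∈ (refl , q∼p))
        (any? (λ (y , q) → (x ≟X y) ×-dec (q ∈? lookup κ p)) (out t))
      edge? nothing  x nothing = no λ ()
      edge? (just _) x _       = no λ ()
      final? : ∀ v → Dec (final roundGraph v)
      final? nothing  = Finite._≟_ (Vec-finite Bool-finite) S′ ⊥
      final? (just _) = no λ ()

    WinsRound : Subsets Tokens-finite → Tokens → Set
    WinsRound W c = ∃ λ c′ → Round c c′ × _∈ˢ_ Tokens-finite c′ W

    abstract
      WinsRound? : ∀ W c → Dec (WinsRound W c)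
      WinsRound? W c = Finite.∃? Tokens-finite λ c′ → Round? c c′ ×-dec _∈ˢ?_ Tokens-finite c′ W

  -- Kernels and winning placements, computed backwards.

  Together : Transition X A.P → Kernel → Fin A.P → Fin A.P → Set
  Together t κ p q = (p ∈ inp t × q ∈ inp t) ⊎ (p ∉ inp t × q ∉ inp t × p ∼[ κ ] q)

  Together? : ∀ t κ p q → Dec (Together t κ p q)
  Together? t κ p q = ((p ∈? inp t) ×-dec (q ∈? inp t)) ⊎-dec
    (¬? (p ∈? inp t) ×-dec ¬? (q ∈? inp t) ×-dec (p ∈? lookup κ q))

  nextKernel : Transition X A.P → Kernel → Kernel
  nextKernel t κ = Vec.tabulate λ q → comprehension (λ p → Together? t κ p q)

  Stuck? : ∀ (c : Tokens) → Dec (proj₁ c ≡ ⊥)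
  Stuck? (T , _) = Finite._≟_ (Vec-finite Bool-finite) T ⊥

  kernel : ∀ {m S} → Run A m S ⊥ → Kernel
  -- On the empty run `consumer` is constant, so all places are related.
  kernel []             = Vec.replicate A.P ⊤
  kernel (step t _ _ R) = nextKernel t (kernel R)

  winning : ∀ {m S} → Run A m S ⊥ → Subsets Tokens-finite
  -- The graph of the empty run has neither edges nor final vertices, so nothing can fire.
  winning [] = subsetOf Tokens-finite Stuck?
  winning {S = S} (step t _ _ R) =
    subsetOf Tokens-finite (WinsRound? t (fire A t S) (kernel R) (winning R))

  -- Both sides obey the same recursion on `R`: the two places are both consumed now, or neither is
  -- and their later consumers agree. Junk values follow it too.
  kernel-spec : ∀ {m S} (R : Run A m S ⊥) {p q} → p ∼[ kernel R ] q ⇔ consumer R p ≡ consumer R q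
  kernel-spec [] {p} {q} = mk⇔ (λ _ → refl)
    (λ _ → subst (p ∈_) (sym (Vec.lookup-replicate q ⊤)) ∈⊤)
  kernel-spec (step t t∈ en R) {p} {q} = mk⇔
    (λ p∼q → case ∈-comprehension⁻ (λ p → Together? t (kernel R) p q) (subst (p ∈_) at p∼q) of λ where
      (inj₁ (p∈ , q∈)) → trans (now p∈) (sym (now q∈))
      (inj₂ (p∉ , q∉ , p∼q)) →
        trans (later p∉) (trans (cong suc (Equivalence.to (kernel-spec R) p∼q)) (sym (later q∉))))
    (λ eq → subst (p ∈_) (sym at) (∈-comprehension⁺ (λ p → Together? t (kernel R) p q)
      (together eq (p ∈? inp t) (q ∈? inp t))))
    where
    now : ∀ {p} → p ∈ inp t → consumer (step t t∈ en R) p ≡ 0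
    now = consumer-now {t = t} {t∈} {en} {R}
    later : ∀ {p} → p ∉ inp t → consumer (step t t∈ en R) p ≡ suc (consumer R p)
    later = consumer-later {t = t} {t∈} {en} {R}
    at : lookup (kernel (step t t∈ en R)) q ≡ comprehension (λ p → Together? t (kernel R) p q)
    at = Vec.lookup∘tabulate _ q
    together : consumer (step t t∈ en R) p ≡ consumer (step t t∈ en R) q →
               Dec (p ∈ inp t) → Dec (q ∈ inp t) → Together t (kernel R) p q
    together eq (yes p∈) (yes q∈) = inj₁ (p∈ , q∈)
    together eq (yes p∈) (no q∉)  = contradiction (trans (sym (now p∈)) (trans eq (later q∉))) λ ()
    together eq (no p∉)  (yes q∈) = contradiction (trans (sym (now q∈)) (trans (sym eq) (later p∉))) λ ()
    together eq (no p∉)  (no q∉)  = inj₂ (p∉ , q∉ , Equivalence.from (kernel-spec R)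
      (ℕ.suc-injective (trans (sym (later p∉)) (trans eq (later q∉)))))

  -- Correctness of a single round.

  module _ {m S} {t : Transition X A.P} {t∈ : t List.∈ A.𝒯} {en : Enabled A t S}
           (R : Run A m (fire A t S) ⊥) where
    private
      R⁺ : Run A (suc m) S ⊥
      R⁺ = step t t∈ en R
      H : LGraph X (Maybe (Fin A.P))
      H = roundGraph t (fire A t S) (kernel R)

    vertexOf : Maybe (Fin A.P) → ℕ
    vertexOf nothing  = 0
    vertexOf (just p) = suc (consumer R p)

    vertexOf-locate : ∀ p → vertexOf (locate t p) ≡ consumer R⁺ p
    vertexOf-locate p with p ∈? inp t
    ... | yes _ = refl
    ... | no _  = refl

    vertexOf-edge : ∀ {v x w} → edge H v x w → runEdge R⁺ (vertexOf v) x (vertexOf w)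
    vertexOf-edge {nothing} {x} {just p} (q , o∈ , q∼p) = q , o∈ , Equivalence.to (kernel-spec R) q∼p

    vertexOf-final : ∀ {v} → final H v → suc (vertexOf v) ≡ suc m
    vertexOf-final {nothing} = cong suc ∘ length≡0 R
      where
      length≡0 : ∀ {m S} → Run A m S ⊥ → S ≡ ⊥ → 0 ≡ m
      length≡0 []              _    = refl
      length≡0 (step t _ en _) refl = contradiction (en (proj₂ (inp≢∅ t))) ∉⊥

    -- Two homomorphisms into the graph of `R⁺` are combined: `vertexOf` maps the round, `suc` maps
    -- the win against the tail, and the images are concatenated.
    Round-sound : ∀ {c c′} → Round t (fire A t S) (kernel R) c c′ →
                  Wins B (runGraph R) (relabel B (consumer R) c′) →
                  Wins B (runGraph R⁺) (relabel B (consumer R⁺) c)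
    Round-sound {T , ps} {T′ , ps′} (νs , ss , agree) w = proj₁ rest , subst
      (λ λs → Star (Step B (runGraph R⁺)) (T , λs) (⊥ , proj₁ rest))
      (trans (sym (Vec.map-∘ vertexOf _ ps)) (Vec.map-cong vertexOf-locate ps))
      (relabel-steps B {H = runGraph R⁺} vertexOf (λ {v} → vertexOf-edge {v})
        (λ {v} → vertexOf-final {v}) ss
        ◅◅ proj₂ rest)
      where
      rest : Wins B (runGraph R⁺) (T′ , Vec.map vertexOf νs)
      rest = Wins-cong B
        (λ q q∈ → trans (Vec.lookup-map q suc (Vec.map (consumer R) ps′))
          (trans (cong suc (Vec.lookup-map q (consumer R) ps′))
          (sym (trans (Vec.lookup-map q vertexOf νs) (cong vertexOf (agree q q∈))))))
        (relabel-wins B {G = runGraph R} {H = runGraph R⁺} suc (λ e → e) (cong suc) w)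

    -- Tokens are compared through `vertexOf` because it is not injective: one vertex may be
    -- represented by several places.
    Follows : Config B (Maybe (Fin A.P)) → Config B ℕ → Set
    Follows (T , νs) (T′ , λs) = T ≡ T′ × (∀ q → q ∈ T → vertexOf (lookup νs q) ≡ lookup λs q)

    -- An edge leaving 0 passes through an output place `p` of `t`, and `just p` represents its
    -- target. Further edges to the same target may use other places; `kernel-spec` relates these to
    -- `p`.
    follow-step : ∀ {d c c′} → SafeFrom B (proj₁ c) → Follows d c → Fires B (runGraph R⁺) 0 c c′ →
                  ∃ λ d′ → Follows d′ c′ × Step B H d d′
    follow-step {T , νs} {.T , λs} {.(fire B u T) , λs′} safe (refl , eq) (u , u∈ , s@(firesBy _ refl _ _ _ _)) =
      (fire B u T , νs′) , (refl , follows) , nothing , u , u∈ , record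
        { enabled = s.enabled
        ; target  = refl
        ; inputs  = λ q q∈ → at-vertex _ (trans (eq q (s.enabled q∈)) (s.inputs q q∈))
        ; last    = λ e → final-state R (ℕ.suc-injective (s.last e))
        ; stable  = λ q q∈ q∉ → proj₂ (proj₂ patched) q (kept q∈ q∉)
        ; edges   = λ {x} {q} o∈ → edge-to (lookup νs′ q) (new q (∈π₂out⁺ u o∈)) (s.edges o∈)
        }
      where
      module s = FiresBy s
      patched = overwrite (π₂out u) (λ q ν → vertexOf ν ≡ lookup λs′ q) νs
        λ q q∈ → target-of (lookup λs′ q) (s.edges (proj₂ (∈π₂out⁻ u q∈)))
        where
        target-of : ∀ l {x} → runEdge R⁺ 0 x l → ∃ λ ν → vertexOf ν ≡ l
        target-of (suc l) (p , _ , eq) = just p , cong suc eq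
      νs′ = proj₁ patched
      new = proj₁ (proj₂ patched)
      kept : ∀ {q} → q ∈ T → q ∉ inp u → q ∉ π₂out u
      kept = SafeFrom-disjoint B safe u∈ s.enabled
      at-vertex : ∀ ν → vertexOf ν ≡ 0 → ν ≡ nothing
      at-vertex nothing  _ = refl
      final-state : ∀ {m S} → Run A m S ⊥ → 0 ≡ m → S ≡ ⊥
      final-state [] _ = refl
      edge-to : ∀ ν {x l} → vertexOf ν ≡ l → runEdge R⁺ 0 x l → edge H nothing x ν
      edge-to (just p) refl (q , o∈ , eq) = q , o∈ , Equivalence.from (kernel-spec R) eq
      follows : ∀ q → q ∈ fire B u T → vertexOf (lookup νs′ q) ≡ lookup λs′ q
      follows q q∈ = case q ∈? π₂out u of λ where
        (yes q∈out) → new q q∈out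
        (no q∉out)  → case ∈-fire⁻ B u q∈ of λ where
          (inj₂ q∈out)      → contradiction q∈out q∉out
          (inj₁ (q∈T , q∉u)) → trans (cong vertexOf (proj₂ (proj₂ patched) q q∉out))
                                (trans (eq q q∈T) (sym (s.stable q q∈T q∉u)))

    follow : ∀ {d c c′} → SafeFrom B (proj₁ c) → Follows d c → Star (Fires B (runGraph R⁺) 0) c c′ →
             ∃ λ d′ → Follows d′ c′ × Star (Step B H) d d′
    follow safe f ε = _ , f , ε
    follow {d} {c} safe f (_◅_ {j = c₁} s ss)
      with d₁ , f₁ , s₁ ← follow-step {d} {c} {c₁} safe f s
      with d′ , f′ , ss′ ← follow (SafeFrom-step B {c = c} {c₁} safe (0 , s)) f₁ ss =
      d′ , f′ , s₁ ◅ ss′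

    -- No edge enters 0, so once tokens have left this vertex none returns. All remaining firings
    -- are at positive vertices and can be shifted down by one.
    descend : ∀ {T λs} → (∀ q → q ∈ T → lookup λs q ≢ 0) →
              ∀ {μs} → Star (Step B (runGraph R⁺)) (T , λs) (⊥ , μs) →
              Wins B (runGraph R) (T , Vec.map pred λs)
    descend later ε = _ , ε
    descend later ((zero , u , u∈ , s) ◅ _) with q₀ , q₀∈ ← inp≢∅ u =
      contradiction (FiresBy.inputs s q₀ q₀∈) (later q₀ (FiresBy.enabled s q₀∈))
    descend {T} {λs} later (_◅_ {j = .(fire B u T) , λs₁} (suc v , u , u∈ , s@(firesBy _ refl _ _ _ _)) ss) =
      proj₁ rest , (v , u , u∈ , record
        { enabled = s.enabled
        ; target  = refl
        ; inputs  = λ q q∈ → trans (Vec.lookup-map q pred λs) (cong pred (s.inputs q q∈))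
        ; last    = ℕ.suc-injective ∘ s.last
        ; stable  = λ q q∈ q∉ → trans (Vec.lookup-map q pred λs₁)
                      (trans (cong pred (s.stable q q∈ q∉)) (sym (Vec.lookup-map q pred λs)))
        ; edges   = λ {x} {q} o∈ → subst (runEdge R v x) (sym (Vec.lookup-map q pred λs₁))
                      (pred-edge (lookup λs₁ q) (s.edges o∈))
        }) ◅ proj₂ rest
      where
      module s = FiresBy s
      pred-edge : ∀ l {x} → runEdge R⁺ (suc v) x l → runEdge R v x (pred l)
      pred-edge (suc l) e = e
      positive : ∀ l {x} → runEdge R⁺ (suc v) x l → l ≢ 0
      positive (suc l) _ ()
      later₁ : ∀ q → q ∈ fire B u T → lookup λs₁ q ≢ 0
      later₁ q q∈ = case ∈-fire⁻ B u q∈ of λ where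
        (inj₁ (q∈T , q∉u)) → later q q∈T ∘ trans (sym (s.stable q q∈T q∉u))
        (inj₂ q∈out)       → positive (lookup λs₁ q) (s.edges (proj₂ (∈π₂out⁻ u q∈out)))
      rest = descend later₁ ss

    located : ∀ (ps : Vec (Fin A.P) B.P) q →
      vertexOf (lookup (Vec.map (locate t) ps) q) ≡ lookup (Vec.map (consumer R⁺) ps) q
    located ps q = trans (cong vertexOf (Vec.lookup-map q _ ps))
      (trans (vertexOf-locate (lookup ps q)) (sym (Vec.lookup-map q _ ps)))

    -- `sources-first` brings the firings at 0 to the front, `follow` lifts them to a round, and
    -- `descend` turns the rest into a win against the tail.
    Round-complete : ∀ {c} → SafeFrom B (proj₁ c) → Wins B (runGraph R⁺) (relabel B (consumer R⁺) c) →
      ∃ λ c′ → Round t (fire A t S) (kernel R) c c′ × SafeFrom B (proj₁ c′) ×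
               Wins B (runGraph R) (relabel B (consumer R) c′)
    Round-complete {T , ps} safe w
      with (T′ , λs′) , ss , avoids , w′ ←
             sources-first B {G = runGraph R⁺} {w = 0} (λ ()) (λ v → v ℕ.≟ 0) safe w
      with (.T′ , νs) , (refl , eq) , ss′ ←
             follow {d = T , Vec.map (locate t) ps} safe (refl , λ q _ → located ps q) ss =
      (T′ , ps′) , (νs , ss′ , agree) , SafeFrom-steps B safe ss′ ,
        Wins-cong B consumers (descend avoids (proj₂ w′))
      where
      -- The default `A.ι` is reached at unmarked places only: marked ones avoid 0, so their labels
      -- are `just`.
      ps′ = Vec.map (fromMaybe A.ι) νs
      waiting : ∀ ν {l} → l ≢ 0 → vertexOf ν ≡ l →
                ν ≡ just (fromMaybe A.ι ν) × pred l ≡ consumer R (fromMaybe A.ι ν)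
      waiting nothing  l≢0 eq   = contradiction (sym eq) l≢0
      waiting (just p) _   refl = refl , refl
      agree : ∀ q → q ∈ T′ → lookup νs q ≡ just (lookup ps′ q)
      agree q q∈ = trans (proj₁ (waiting (lookup νs q) (avoids q q∈) (eq q q∈)))
        (cong just (sym (Vec.lookup-map q _ νs)))
      consumers : ∀ q → q ∈ T′ → lookup (Vec.map pred λs′) q ≡ lookup (Vec.map (consumer R) ps′) q
      consumers q q∈ = trans (Vec.lookup-map q pred λs′)
        (trans (proj₂ (waiting (lookup νs q) (avoids q q∈) (eq q q∈)))
        (sym (trans (Vec.lookup-map q (consumer R) ps′) (cong (consumer R) (Vec.lookup-map q _ νs)))))

  -- Correctness of the winning placements.

  winning-sound : ∀ {m S} (R : Run A m S ⊥) {c} → _∈ˢ_ Tokens-finite c (winning R) →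
                  Wins B (runGraph R) (relabel B (consumer R) c)
  winning-sound [] {c} c∈ with refl ← ∈-subsetOf⁻ Tokens-finite Stuck? {c} c∈ = _ , ε
  winning-sound {S = S} (step t t∈ en R) {c} c∈
    with c′ , round , c′∈ ←
           ∈-subsetOf⁻ Tokens-finite (WinsRound? t (fire A t S) (kernel R) (winning R)) {c} c∈ =
    Round-sound {t = t} {t∈} {en} R {c} {c′} round (winning-sound R {c′} c′∈)

  winning-complete : ∀ {m S} (R : Run A m S ⊥) {c} → SafeFrom B (proj₁ c) →
                     Wins B (runGraph R) (relabel B (consumer R) c) → _∈ˢ_ Tokens-finite c (winning R)
  winning-complete [] {c} safe w = ∈-subsetOf⁺ Tokens-finite Stuck? {c} (stuck w)
    where
    stuck : ∀ {c} → Wins B (runGraph {N = A} {S = ⊥} []) c → proj₁ c ≡ ⊥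
    stuck (_ , ε) = refl
    stuck (_ , (v , u , _ , s) ◅ _) with out u | FiresBy.last s | FiresBy.edges s
    ... | []    | last | _     = contradiction (last refl) λ ()
    ... | _ ∷ _ | _    | edges = contradiction (edges (here refl)) λ ()
  winning-complete {S = S} (step t t∈ en R) {c} safe w
    with c′ , round , safe′ , w′ ← Round-complete {t = t} {t∈} {en} R {c} safe w =
    ∈-subsetOf⁺ Tokens-finite (WinsRound? t (fire A t S) (kernel R) (winning R)) {c}
      (c′ , round , winning-complete R {c′} safe′ w′)

  -- The finite graph of summaries.

  Summary : Set
  Summary = State A × Kernel × Subsets Tokens-finite

  Summary-finite : Finite Summary
  Summary-finite = ×-finite (Vec-finite Bool-finite)
    (×-finite (Vec-finite (Vec-finite Bool-finite)) (Vec-finite Bool-finite))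

  summary : ∀ {m S} → Run A m S ⊥ → Summary
  summary {S = S} R = S , kernel R , winning R

  -- An edge puts a transition in front of a run. The new kernel and winning set are computed from
  -- the old summary and `t`; the new state `S` is only constrained, as firing `t` cannot be
  -- inverted.
  Precedes : Summary → Summary → Set
  Precedes (S′ , κ′ , W′) (S , κ , W) = ∃ λ t → t List.∈ A.𝒯 × Enabled A t S × S′ ≡ fire A t S ×
    κ ≡ nextKernel t κ′ × W ≡ subsetOf Tokens-finite (WinsRound? t S′ κ′ W′)

  Precedes? : Decidable Precedes
  Precedes? (S′ , κ′ , W′) (S , κ , W) = map′ List.find (λ (t , t∈ , p) → List.lose t∈ p)
    (any? (λ t → (inp t ⊆? S)
           ×-dec Finite._≟_ (Vec-finite Bool-finite) S′ (fire A t S)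
           ×-dec Finite._≟_ (Vec-finite (Vec-finite Bool-finite)) κ (nextKernel t κ′)
           ×-dec Finite._≟_ (Vec-finite Bool-finite) W (subsetOf Tokens-finite (WinsRound? t S′ κ′ W′)))
      A.𝒯)

  Summarises : Summary → Set
  Summarises σ = ∃₂ λ m S → ∃ λ (R : Run A m S ⊥) → summary R ≡ σ

  empty-summary : Summary
  empty-summary = summary []

  -- Each edge supplies a transition, so a path spells out a run. With `summary-reachable`, the
  -- nodes reachable from `empty-summary` are exactly the summaries of runs to `⊥`.
  Star⇒Summarises : ∀ {σ τ} → Summarises σ → Star Precedes σ τ → Summarises τ
  Star⇒Summarises r ε = r
  Star⇒Summarises (m , _ , R , refl) ((t , t∈ , en , refl , refl , refl) ◅ ps) =
    Star⇒Summarises (suc m , _ , step t t∈ en R , refl) ps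

  summary-reachable : ∀ {m S} (R : Run A m S ⊥) → Star Precedes empty-summary (summary R)
  summary-reachable []               = ε
  summary-reachable (step t t∈ en R) = summary-reachable R ◅◅ (t , t∈ , en , refl , refl , refl) ◅ ε

  -- The first transition of an accepting run consumes `A.ι`, so this place stands for the input of
  -- the trace.
  initial : Tokens
  initial = ⁅ B.ι ⁆ , Vec.replicate B.P A.ι

  Loses : Summary → Set
  Loses (S , _ , W) = S ≡ ⁅ A.ι ⁆ × ¬ _∈ˢ_ Tokens-finite initial W

  losing? : Dec (∃ λ σ → Star Precedes empty-summary σ × Loses σ)
  losing? = Finite.∃? Summary-finite λ (S , κ , W) →
    Star? Summary-finite Precedes Precedes? empty-summary (S , κ , W)
    ×-dec (Finite._≟_ (Vec-finite Bool-finite) S ⁅ A.ι ⁆)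
    ×-dec ¬? (_∈ˢ?_ Tokens-finite initial W)

  relabel-initial : ∀ {n} (R : AcceptingRun A n) → relabel B (consumer R) initial ≡ start {B = B} R
  relabel-initial R = cong (⁅ B.ι ⁆ ,_) (trans (Vec.map-replicate (consumer R) A.ι B.P)
    (cong (Vec.replicate B.P) (first R)))
    where
    first : ∀ {n} (R : AcceptingRun A n) → consumer R A.ι ≡ 0
    first (step t t∈ en R) = consumer-now {t = t} {t∈} {en} {R} (ι∈ (inp≢∅ t))
      where
      ι∈ : Nonempty (inp t) → A.ι ∈ inp t
      ι∈ (p , p∈) = subst (_∈ inp t) (x∈⁅y⁆⇒x≡y A.ι (en p∈)) p∈

  AllReadable : Set
  AllReadable = ∀ {n} (R : AcceptingRun A n) → Readable {N = B} (trace R)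

  -- A reachable losing summary yields an accepting run whose trace is unreadable by
  -- `winning-complete`. If there is none, `initial` wins against every accepting run and
  -- `winning-sound` applies.
  allReadable? : SafeFrom B ⁅ B.ι ⁆ → Dec AllReadable
  allReadable? safe with losing?
  ... | yes (_ , reached , refl , lost) with Star⇒Summarises (_ , _ , [] , refl) reached
  ...   | suc _ , _ , R , refl = no λ readable → lost
          (winning-complete R {initial} safe (subst (Wins B (runGraph R)) (sym (relabel-initial R))
            (Readable⇒Wins {A = A} {B} R (readable R))))
  -- The empty run starts in `⊥`, which is not the singleton of `A.ι`.
  ...   | zero , _ , [] , eq =
          contradiction (subst (A.ι ∈_) (sym (cong proj₁ eq)) (x∈⁅x⁆ A.ι)) ∉⊥
  allReadable? safe | no ¬losing = yes λ R → Wins⇒Readable {A = A} {B} R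
    (subst (Wins B (runGraph R)) (relabel-initial R) (winning-sound R {initial}
      (decidable-stable (_∈ˢ?_ Tokens-finite initial (winning R))
        (λ lost → ¬losing (summary R , summary-reachable R , refl , lost)))))

-- Reduction of the inclusion to the traces themselves.

≅-refl : ∀ {X n} {G : Graph X n} → G ≅ G
≅-refl = record
  { vertices    = ↔-id _
  ; ι-preserved = refl
  ; o-preserved = refl
  ; E-preserved = λ _ _ _ → ⇔-id _
  }

theorem9p11 : {X : Set} → DecidableEquality X → (A B : PetriAutomaton X) →
    Dec (∀ {m : ℕ} (G : Graph X m) → 𝓖 A G → 𝓛 B G)
theorem9p11 _≟_ A B = map′
  -- Readings are transported along isomorphisms, so reading each trace suffices; conversely each
  -- trace belongs to `𝓖 A`.
  (λ readable G (n , R , iso) → case Readable⇒Reading (readable R) of λ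
    { (k , R′ , r) → k , R′ , Reading-≅ iso r })
  (λ inclusion {_} R → case inclusion (trace R) (_ , R , ≅-refl) of λ
    { (_ , _ , r) → Reading⇒Readable r })
  (Rounds.allReadable? _≟_ A.net B.net (λ R u∈ en → B.safe (_ , R) u∈ en))
  where
  module A = PetriAutomaton A
  module B = PetriAutomaton B
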